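{- For any graph $G$, $$\gamma_I(G)+\partial_s(G)=n(G).$$
   Context: Graphs are finite, simple, undirected, with non-empty vertex set; $n(G)=|V(G)|$ and $N(v)$ is the open neighbourhood of $v$. For $D\subseteq V(G)$: $N_e(D)=\{u\in V(G)\setminus D:\ N(u)\cap D\ne\varnothing\}$; for $v\in D$, $\mathrm{epn}(v,D)=\{u\in V(G)\setminus D:\ N(u)\cap D=\{v\}\}$; $D_w=\{v\in D:\ \mathrm{epn}(v,D)\neq\varnothing\}$. The strong differential of $D$ is $\partial_s(D)=|N_e(D)|-|D_w|$, and the strong differential of $G$ is $\partial_s(G)=\max\{\partial_s(D):\ D\subseteq V(G)\}$. An Italian dominating function on $G$ is a function $f:V(G)\to\{0,1,2\}$ such that $\sum_{u\in N(v)}f(u)\ge 2$ for every $v\in V(G)$ with $f(v)=0$; its weight is $\sum_{v\in V(G)}f(v)$. The Italian domination number $\gamma_I(G)$ is the minimum weight among all Italian dominating functions on $G$. -}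

module Defs where

open import Data.Bool.Base using (true; false)
import Data.Bool.Properties as Bool
open import Data.Fin.Base using (Fin; zero; suc; toℕ)
import Data.Fin.Properties as Fin
open import Data.Fin.Subset using (Subset; _∩_; ⁅_⁆; ∣_∣; ⊥)
open import Data.Fin.Subset.Properties using (_∈?_; nonempty?)
open import Data.Integer.Base as ℤ using (ℤ; +_)
import Data.Integer.Properties as ℤ
open import Data.List.Base as List using (List; []; _∷_; allFin; cartesianProductWith; filter)
open import Data.List.Extrema ℤ.≤-totalOrder using (argmax; f[xs]≤f[argmax])
open import Data.List.Extrema.Nat using (argmin; argmin-all; f[argmin]≤f[xs])
import Data.List.Membership.Propositional as List
import Data.List.Membership.Propositional.Properties as List
open import Data.List.Relation.Unary.All using (lookup)
open import Data.List.Relation.Unary.All.Properties using (all-filter)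
open import Data.List.Relation.Unary.Any using (here; there)
open import Data.Nat.Base as ℕ using (ℕ; zero; suc; NonZero)
import Data.Nat.Properties as ℕ
open import Data.Nat.ListAction using (sum)
open import Data.Product.Base using (∃; _×_; _,_)
open import Data.Vec.Base as Vec using (Vec; []; _∷_; replicate; tabulate)
import Data.Vec.Properties as Vec
open import Level using (0ℓ)
open import Relation.Binary.Core using (Rel)
open import Relation.Binary.Definitions using (Decidable; Symmetric; Irreflexive)
open import Relation.Binary.PropositionalEquality using (_≡_; refl; sym; trans; cong)
open import Relation.Nullary.Decidable using (does; _×-dec_; _→-dec_; ¬?)
open import Relation.Nullary.Negation using (contradiction)
import Relation.Unary as U

record Graph : Set₁ where
  field
    order      : ℕ
    .{{nonempty}} : NonZero order
    Adj        : Rel (Fin order) 0ℓ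
    adj?       : Decidable Adj
    adj-sym    : Symmetric Adj
    adj-irrefl : Irreflexive _≡_ Adj

  Vertex : Set
  Vertex = Fin order

n : Graph → ℕ
n = Graph.order

comprehension : ∀ {m} {P : Fin m → Set} → U.Decidable P → Subset m
comprehension P? = tabulate (λ i → does (P? i))

∑[_] : ∀ {m} → Subset m → (Fin m → ℕ) → ℕ
∑[ S ] g = sum (List.map g (filter (_∈? S) (allFin _)))

vectors : ∀ {A : Set} → List A → ∀ m → List (Vec A m)
vectors xs zero    = [] ∷ []
vectors xs (suc m) = cartesianProductWith _∷_ xs (vectors xs m)

∈-vectors : ∀ {A : Set} {xs : List A} → (∀ x → x List.∈ xs) →
            ∀ {m} (v : Vec A m) → v List.∈ vectors xs m
∈-vectors all []      = here refl
∈-vectors all (x ∷ v) = List.∈-cartesianProductWith⁺ _∷_ (all x) (∈-vectors all v)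

subsets : ∀ m → List (Subset m)
subsets = vectors (true ∷ false ∷ [])

∈-subsets : ∀ {m} (D : Subset m) → D List.∈ subsets m
∈-subsets = ∈-vectors λ { true → here refl ; false → there (here refl) }

module _ (G : Graph) where
  open Graph G

  N : Vertex → Subset order
  N v = comprehension (adj? v)

  Nₑ : Subset order → Subset order
  Nₑ D = comprehension λ u → ¬? (u ∈? D) ×-dec nonempty? (N u ∩ D)

  epn : Vertex → Subset order → Subset order
  epn v D = comprehension λ u →
    ¬? (u ∈? D) ×-dec Vec.≡-dec Bool._≟_ (N u ∩ D) ⁅ v ⁆

  Dw : Subset order → Subset order
  Dw D = comprehension λ v → (v ∈? D) ×-dec nonempty? (epn v D)

  ∂ₛ-of : Subset order → ℤ
  ∂ₛ-of D = + ∣ Nₑ D ∣ ℤ.- + ∣ Dw D ∣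

  ∂ₛ : ℤ
  ∂ₛ = ∂ₛ-of (argmax ∂ₛ-of ⊥ (subsets order))

  ∂ₛ-attained : ∃ λ D → ∂ₛ-of D ≡ ∂ₛ
  ∂ₛ-attained = _ , refl

  ∂ₛ-upper : ∀ D → ∂ₛ-of D ℤ.≤ ∂ₛ
  ∂ₛ-upper D = lookup (f[xs]≤f[argmax] ⊥ (subsets order)) (∈-subsets D)

  Labelling : Set
  Labelling = Vec (Fin 3) order

  value : Labelling → Vertex → ℕ
  value f v = toℕ (Vec.lookup f v)

  IsItalian : Labelling → Set
  IsItalian f = ∀ v → value f v ≡ 0 → 2 ℕ.≤ ∑[ N v ] (value f)

  isItalian? : U.Decidable IsItalian
  isItalian? f = Fin.all? λ v → (value f v ℕ.≟ 0) →-dec (2 ℕ.≤? ∑[ N v ] (value f))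

  weight : Labelling → ℕ
  weight f = sum (List.map (value f) (allFin order))

  allTwo : Labelling
  allTwo = replicate order (suc (suc zero))

  allTwo-isItalian : IsItalian allTwo
  allTwo-isItalian v eq = contradiction
    (trans (sym (cong toℕ (Vec.lookup-replicate v (suc (suc zero))))) eq) λ ()

  italians : List Labelling
  italians = filter isItalian? (vectors (allFin 3) order)

  optimal : Labelling
  optimal = argmin weight allTwo italians

  -- allTwo is only the starting value of the search; it is Italian, so the
  -- result is the least weight of an Italian dominating function.
  γI : ℕ
  γI = weight optimal

  γI-attained : ∃ λ f → IsItalian f × weight f ≡ γI
  γI-attained = optimal , isItalian , refl
    where
    isItalian : IsItalian optimal
    isItalian = argmin-all weight {P = IsItalian} allTwo-isItalian
      (all-filter isItalian? (vectors (allFin 3) order))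

  γI-lower : ∀ f → IsItalian f → γI ℕ.≤ weight f
  γI-lower f p = lookup (f[argmin]≤f[xs] allTwo italians)
    (List.∈-filter⁺ isItalian? (∈-vectors List.∈-allFin f) p)

{-# OPTIONS --safe #-}

-- Given D, label the vertices of Dw D by 2, those of Nₑ D by 0 and all others
-- by 1: the result is Italian, of weight at most n - ∂ₛ(D).  Given an Italian f,
-- take for D its support: every vertex outside D lies in Nₑ D, and f is 2 on
-- Dw D, since the only neighbour in D of a private neighbour must carry
-- weight 2 alone; hence ∂ₛ(D) is at least n minus the weight of f.
module Submission where

open import Defs
open import Data.Bool.Base using (Bool; true; false; if_then_else_)
import Data.Bool.Properties as Bool
open import Data.Fin.Base using (Fin; zero; suc; toℕ)
open import Data.Fin.Subset using (Subset; inside; outside; _∈_; _∉_; _∩_; ⁅_⁆; ∣_∣; ⊥; Nonempty)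
open import Data.Fin.Subset.Properties
  using (_∈?_; _⊂?_; nonempty?; x∈⁅y⁆⇒x≡y; ∣⁅x⁆∣≡1; p⊂q⇒∣p∣<∣q∣; ⊆-antisym; x∈p∩q⁺; x∈p∩q⁻)
open import Data.Integer.Base using (+_; _+_)
import Data.Integer.Base as ℤ
import Data.Integer.Properties as ℤ
open import Data.List.Base as List using ([]; _∷_; allFin; filter)
open import Data.List.Properties using (map-tabulate)
open import Data.Nat.Base as ℕ using (ℕ; zero; suc; _≤_; z≤n; s≤s)
import Data.Nat.ListAction as ListAction
import Data.Nat.Properties as ℕ
open import Data.Product.Base using (∃; _×_; _,_; proj₁; proj₂)
open import Data.Sum.Base using (_⊎_; inj₁; inj₂)
open import Data.Vec.Base as Vec using ([]; _∷_)
open import Data.Vec.Properties using (≡-dec; lookup∘tabulate; lookup⇒[]=; []=⇒lookup)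
open import Function.Base using (_∘_; id)
open import Relation.Binary.PropositionalEquality
  using (_≡_; _≢_; refl; sym; trans; cong; cong₂; subst; subst₂)
open import Relation.Nullary.Decidable using (Dec; does; yes; no; ¬?; _×-dec_; dec-true; dec-false)
open import Relation.Nullary.Negation using (contradiction)
import Relation.Unary as U

open import Algebra.Properties.CommutativeMonoid.Sum ℕ.+-0-commutativeMonoid
  using (sum; ∑-distrib-+)

private variable
  m : ℕ

-- Comprehensions, finite sums and cardinalities of subsets.

does-true : ∀ {A : Set} (a? : Dec A) → does a? ≡ true → A
does-true (yes a) _ = a

module _ {P : Fin m → Set} (P? : U.Decidable P) where

  ∈-comprehension⁺ : ∀ {i} → P i → i ∈ comprehension P?
  ∈-comprehension⁺ {i} p =
    lookup⇒[]= i _ (trans (lookup∘tabulate _ i) (dec-true (P? i) p))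

  ∈-comprehension⁻ : ∀ {i} → i ∈ comprehension P? → P i
  ∈-comprehension⁻ {i} i∈ =
    does-true (P? i) (trans (sym (lookup∘tabulate _ i)) ([]=⇒lookup i∈))

sum-mono : {g h : Fin m → ℕ} → (∀ i → g i ≤ h i) → sum g ≤ sum h
sum-mono {zero}  g≤h = z≤n
sum-mono {suc m} g≤h = ℕ.+-mono-≤ (g≤h zero) (sum-mono (g≤h ∘ suc))

sum-tabulate : (g : Fin m → ℕ) → ListAction.sum (List.tabulate g) ≡ sum g
sum-tabulate {zero}  g = refl
sum-tabulate {suc m} g = cong (g zero ℕ.+_) (sum-tabulate (g ∘ suc))

sum-allFin : (g : Fin m → ℕ) → ListAction.sum (List.map g (allFin m)) ≡ sum g
sum-allFin g = trans (cong ListAction.sum (map-tabulate id g)) (sum-tabulate g)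

sum-ones : ∀ m → sum {m} (λ _ → 1) ≡ m
sum-ones zero    = refl
sum-ones (suc m) = cong suc (sum-ones m)

-- Extension by zero: sums over different subsets become sums over the same index set and can be
-- compared index by index.
restrict : Subset m → (Fin m → ℕ) → Fin m → ℕ
restrict S g i = if does (i ∈? S) then g i else 0

indicator : Subset m → Fin m → ℕ
indicator S = restrict S (λ _ → 1)

sum-map-filter : ∀ {A : Set} {P : A → Set} (P? : U.Decidable P) (g : A → ℕ) xs →
  ListAction.sum (List.map g (filter P? xs)) ≡
  ListAction.sum (List.map (λ x → if does (P? x) then g x else 0) xs)
sum-map-filter P? g []       = refl
sum-map-filter P? g (x ∷ xs) with does (P? x)
... | true  = cong (g x ℕ.+_) (sum-map-filter P? g xs)
... | false = sum-map-filter P? g xs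

∑-restrict : (S : Subset m) (g : Fin m → ℕ) → ∑[ S ] g ≡ sum (restrict S g)
∑-restrict S g = trans (sum-map-filter (_∈? S) g (allFin _)) (sum-allFin (restrict S g))

∣S∣≡sum-indicator : (S : Subset m) → ∣ S ∣ ≡ sum (indicator S)
∣S∣≡sum-indicator []            = refl
∣S∣≡sum-indicator (inside  ∷ S) = cong suc (∣S∣≡sum-indicator S)
∣S∣≡sum-indicator (outside ∷ S) = ∣S∣≡sum-indicator S

∣S∣≡∑1 : (S : Subset m) → ∣ S ∣ ≡ ∑[ S ] (λ _ → 1)
∣S∣≡∑1 S = trans (∣S∣≡sum-indicator S) (sym (∑-restrict S _))

sum-restrict-⊥ : (g : Fin m → ℕ) → sum (restrict ⊥ g) ≡ 0
sum-restrict-⊥ {zero}  g = refl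
sum-restrict-⊥ {suc m} g = sum-restrict-⊥ (g ∘ suc)

sum-restrict-⁅⁆ : (g : Fin m → ℕ) (v : Fin m) → sum (restrict ⁅ v ⁆ g) ≡ g v
sum-restrict-⁅⁆ g zero    =
  trans (cong (g zero ℕ.+_) (sum-restrict-⊥ (g ∘ suc))) (ℕ.+-identityʳ _)
sum-restrict-⁅⁆ g (suc v) = sum-restrict-⁅⁆ (g ∘ suc) v

∑-⁅⁆ : (g : Fin m → ℕ) (v : Fin m) → ∑[ ⁅ v ⁆ ] g ≡ g v
∑-⁅⁆ g v = trans (∑-restrict ⁅ v ⁆ g) (sum-restrict-⁅⁆ g v)

-- An element of `S` may fall outside `T` as long as `g` vanishes there. This is what allows a sum
-- over a neighbourhood to shrink to a single vertex when all other neighbours carry value 0.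
∑-mono : (S T : Subset m) {g h : Fin m → ℕ} →
         (∀ {i} → i ∈ S → i ∈ T ⊎ g i ≡ 0) → (∀ {i} → i ∈ S → g i ≤ h i) →
         ∑[ S ] g ≤ ∑[ T ] h
∑-mono S T {g} {h} S⊆T g≤h =
  subst₂ _≤_ (sym (∑-restrict S g)) (sym (∑-restrict T h)) (sum-mono pointwise)
  where
  pointwise : ∀ i → restrict S g i ≤ restrict T h i
  pointwise i with i ∈? S
  ... | no _ = z≤n
  ... | yes i∈S with i ∈? T | S⊆T i∈S
  ...   | yes _  | _         = g≤h i∈S
  ...   | no i∉T | inj₁ i∈T  = contradiction i∈T i∉T
  ...   | no _   | inj₂ gi≡0 = ℕ.≤-reflexive gi≡0

-- Absorbs a cardinality into a sum over all indices, so that the two counting inequalities below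
-- reduce to checks at each vertex.
sum-+-indicator : (g : Fin m → ℕ) (S : Subset m) →
                  sum (λ i → g i ℕ.+ indicator S i) ≡ sum g ℕ.+ ∣ S ∣
sum-+-indicator g S =
  trans (∑-distrib-+ g (indicator S)) (cong (sum g ℕ.+_) (sym (∣S∣≡sum-indicator S)))

sum-1+indicator : (S : Subset m) → sum (λ i → 1 ℕ.+ indicator S i) ≡ m ℕ.+ ∣ S ∣
sum-1+indicator S = trans (sum-+-indicator _ S) (cong (ℕ._+ ∣ S ∣) (sum-ones _))

-- Once `v` lies in `T`, the singleton is either all of `T` or strictly contained in it, and strict
-- inclusion pushes the cardinality above 1. With `T` the set of neighbours of `u` in `D`, the first
-- case says that `u` is a private neighbour of `v`.
singleton-or-2≤ : {T : Subset m} {v : Fin m} → v ∈ T → T ≡ ⁅ v ⁆ ⊎ 2 ≤ ∣ T ∣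
singleton-or-2≤ {T = T} {v} v∈T with ⁅ v ⁆ ⊂? T
... | yes v⊂T = inj₂ (subst (ℕ._< ∣ T ∣) (∣⁅x⁆∣≡1 v) (p⊂q⇒∣p∣<∣q∣ v⊂T))
... | no  v⊄T = inj₁ (⊆-antisym T⊆v v⊆T)
  where
  v⊆T : ∀ {x} → x ∈ ⁅ v ⁆ → x ∈ T
  v⊆T x∈v = subst (_∈ T) (sym (x∈⁅y⁆⇒x≡y v x∈v)) v∈T

  T⊆v : ∀ {x} → x ∈ T → x ∈ ⁅ v ⁆
  T⊆v {x} x∈T with x ∈? ⁅ v ⁆
  ... | yes x∈v = x∈v
  ... | no  x∉v = contradiction ((λ {_} → v⊆T) , x , x∈T , x∉v) v⊄T

-- Membership in the sets attached to `D`.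

module _ (G : Graph) where
  open Graph G

  private
    -- These repeat the decision procedures inside `Nₑ`, `epn` and `Dw`, so that
    -- `comprehension (Nₑ? D)` is `Nₑ G D` by definition, and likewise for the other two.
    Nₑ? : ∀ D → U.Decidable (λ u → u ∉ D × Nonempty (N G u ∩ D))
    Nₑ? D u = ¬? (u ∈? D) ×-dec nonempty? (N G u ∩ D)

    epn? : ∀ v D → U.Decidable (λ u → u ∉ D × N G u ∩ D ≡ ⁅ v ⁆)
    epn? v D u = ¬? (u ∈? D) ×-dec ≡-dec Bool._≟_ (N G u ∩ D) ⁅ v ⁆

    Dw? : ∀ D → U.Decidable (λ v → v ∈ D × Nonempty (epn G v D))
    Dw? D v = (v ∈? D) ×-dec nonempty? (epn G v D)

  ∈Nₑ⁺ : ∀ {D u v} → u ∉ D → v ∈ N G u ∩ D → u ∈ Nₑ G D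
  ∈Nₑ⁺ {D} u∉D v∈ = ∈-comprehension⁺ (Nₑ? D) (u∉D , _ , v∈)

  ∈Nₑ⁻ : ∀ {D u} → u ∈ Nₑ G D → u ∉ D × Nonempty (N G u ∩ D)
  ∈Nₑ⁻ {D} = ∈-comprehension⁻ (Nₑ? D)

  ∈Dw⁺ : ∀ {D u v} → v ∈ D → u ∉ D → N G u ∩ D ≡ ⁅ v ⁆ → v ∈ Dw G D
  ∈Dw⁺ {D} {v = v} v∈D u∉D eq =
    ∈-comprehension⁺ (Dw? D) (v∈D , _ , ∈-comprehension⁺ (epn? v D) (u∉D , eq))

  ∈Dw⁻ : ∀ {D v} → v ∈ Dw G D → ∃ λ u → u ∉ D × N G u ∩ D ≡ ⁅ v ⁆
  ∈Dw⁻ {D} {v} v∈Dw with ∈-comprehension⁻ (Dw? D) v∈Dw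
  ... | _ , u , u∈epn = u , ∈-comprehension⁻ (epn? v D) u∈epn

  weight≡sum : (f : Labelling G) → weight G f ≡ sum (value G f)
  weight≡sum f = sum-allFin (value G f)

  -- From a set to an Italian dominating function.

  module FromSet (D : Subset order) where

    -- The flags stand for membership in `Nₑ G D` and in `Dw G D`. They never hold together, since
    -- `Dw G D` lies inside `D` and `Nₑ G D` outside it.
    label : Bool → Bool → Fin 3
    label true  _     = zero
    label false true  = suc (suc zero)
    label false false = suc zero

    labelling : Labelling G
    labelling = Vec.tabulate λ v → label (does (v ∈? Nₑ G D)) (does (v ∈? Dw G D))

    value-labelling : ∀ v → value G labelling v ≡
                      toℕ (label (does (v ∈? Nₑ G D)) (does (v ∈? Dw G D)))
    value-labelling v = cong toℕ (lookup∘tabulate _ v)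

    value≡0⇒∈Nₑ : ∀ {v} → value G labelling v ≡ 0 → v ∈ Nₑ G D
    value≡0⇒∈Nₑ {v} eq with trans (sym (value-labelling v)) eq
    -- Outside `Nₑ G D` the label computes to 2 or 1, which refutes `eq′`; both flags must be split
    -- for it to compute.
    ... | eq′ with v ∈? Nₑ G D | does (v ∈? Dw G D)
    ...   | yes v∈ | _ = v∈
    value≡0⇒∈Nₑ eq | () | no _ | true
    value≡0⇒∈Nₑ eq | () | no _ | false

    ∈D⇒1≤value : ∀ {v} → v ∈ D → 1 ≤ value G labelling v
    ∈D⇒1≤value v∈D =
      ℕ.n≢0⇒n>0 λ eq → proj₁ (∈Nₑ⁻ (value≡0⇒∈Nₑ eq)) v∈D

    ∈Dw⇒value≡2 : ∀ {v} → v ∈ D → v ∈ Dw G D → value G labelling v ≡ 2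
    ∈Dw⇒value≡2 {v} v∈D v∈Dw = trans (value-labelling v)
      (cong₂ (λ a b → toℕ (label a b))
        (dec-false (v ∈? Nₑ G D) λ v∈Nₑ → proj₁ (∈Nₑ⁻ v∈Nₑ) v∈D)
        (dec-true (v ∈? Dw G D) v∈Dw))

    labelling-isItalian : IsItalian G labelling
    labelling-isItalian u eq with ∈Nₑ⁻ (value≡0⇒∈Nₑ eq)
    ... | u∉D , v , v∈T = bound (singleton-or-2≤ v∈T)
      where
      open ℕ.≤-Reasoning

      T : Subset order
      T = N G u ∩ D

      T⊆N : ∀ {w} → w ∈ T → w ∈ N G u
      T⊆N = proj₁ ∘ x∈p∩q⁻ (N G u) D

      T⊆D : ∀ {w} → w ∈ T → w ∈ D
      T⊆D = proj₂ ∘ x∈p∩q⁻ (N G u) D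

      bound : T ≡ ⁅ v ⁆ ⊎ 2 ≤ ∣ T ∣ → 2 ≤ ∑[ N G u ] (value G labelling)
      -- `u` is a private neighbour of `v`, so `v` is in `Dw G D` and its label 2 suffices alone.
      bound (inj₁ T≡v) = begin
        2                                ≡⟨ ∈Dw⇒value≡2 (T⊆D v∈T) (∈Dw⁺ (T⊆D v∈T) u∉D T≡v) ⟨
        value G labelling v              ≡⟨ ∑-⁅⁆ _ v ⟨
        ∑[ ⁅ v ⁆ ] (value G labelling)   ≡⟨ cong (λ S → ∑[ S ] (value G labelling)) T≡v ⟨
        ∑[ T ] (value G labelling)       ≤⟨ ∑-mono T (N G u) (inj₁ ∘ T⊆N) (λ _ → ℕ.≤-refl) ⟩
        ∑[ N G u ] (value G labelling)   ∎
      -- At least two neighbours of `u` lie in `D`, where no label is 0.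
      bound (inj₂ 2≤∣T∣) = begin
        2                                ≤⟨ 2≤∣T∣ ⟩
        ∣ T ∣                            ≡⟨ ∣S∣≡∑1 T ⟩
        ∑[ T ] (λ _ → 1)                 ≤⟨ ∑-mono T (N G u) (inj₁ ∘ T⊆N) (∈D⇒1≤value ∘ T⊆D) ⟩
        ∑[ N G u ] (value G labelling)   ∎

    -- Stated with sums on both sides to avoid subtraction in `ℕ`. At each vertex, label 0 is paired
    -- with a unit from `Nₑ G D`, and label 2 occurs only where `Dw G D` supplies a second unit on
    -- the right.
    weight-labelling : weight G labelling ℕ.+ ∣ Nₑ G D ∣ ≤ order ℕ.+ ∣ Dw G D ∣
    weight-labelling = begin
      weight G labelling ℕ.+ ∣ Nₑ G D ∣                            ≡⟨ cong (ℕ._+ ∣ Nₑ G D ∣) (weight≡sum labelling) ⟩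
      sum (value G labelling) ℕ.+ ∣ Nₑ G D ∣                       ≡⟨ sum-+-indicator _ (Nₑ G D) ⟨
      sum (λ v → value G labelling v ℕ.+ indicator (Nₑ G D) v)     ≤⟨ sum-mono pointwise ⟩
      sum (λ v → 1 ℕ.+ indicator (Dw G D) v)                       ≡⟨ sum-1+indicator (Dw G D) ⟩
      order ℕ.+ ∣ Dw G D ∣                                         ∎
      where
      open ℕ.≤-Reasoning
      pointwise : ∀ v → value G labelling v ℕ.+ indicator (Nₑ G D) v ≤
                        1 ℕ.+ indicator (Dw G D) v
      pointwise v rewrite value-labelling v
        with does (v ∈? Nₑ G D) | does (v ∈? Dw G D)
      ... | true  | _     = s≤s z≤n
      ... | false | true  = ℕ.≤-refl
      ... | false | false = ℕ.≤-refl

  -- From an Italian dominating function to its support.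

  module FromLabelling (f : Labelling G) (italian : IsItalian G f) where

    nonzero? : U.Decidable (λ v → value G f v ≢ 0)
    nonzero? v = ¬? (value G f v ℕ.≟ 0)

    support : Subset order
    support = comprehension nonzero?

    ∉support⇒≡0 : ∀ {v} → v ∉ support → value G f v ≡ 0
    ∉support⇒≡0 {v} v∉ with value G f v ℕ.≟ 0
    ... | yes eq = eq
    ... | no neq = contradiction (∈-comprehension⁺ nonzero? neq) v∉

    -- All nonzero values around `u` sit at `v`, so the Italian condition at `u` falls on `v` alone.
    -- Assuming an inclusion rather than an equality also covers a `u` with no neighbour in the
    -- support.
    2≤value : ∀ {u v} → value G f u ≡ 0 →
              (∀ {w} → w ∈ N G u ∩ support → w ∈ ⁅ v ⁆) → 2 ≤ value G f v
    2≤value {u} {v} fu≡0 ⊆v = begin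
      2                        ≤⟨ italian u fu≡0 ⟩
      ∑[ N G u ] (value G f)   ≤⟨ ∑-mono (N G u) ⁅ v ⁆ inside-or-zero (λ _ → ℕ.≤-refl) ⟩
      ∑[ ⁅ v ⁆ ] (value G f)   ≡⟨ ∑-⁅⁆ _ v ⟩
      value G f v              ∎
      where
      open ℕ.≤-Reasoning
      inside-or-zero : ∀ {w} → w ∈ N G u → w ∈ ⁅ v ⁆ ⊎ value G f w ≡ 0
      inside-or-zero {w} w∈N with w ∈? support
      ... | yes w∈ = inj₁ (⊆v (x∈p∩q⁺ (w∈N , w∈)))
      ... | no  w∉ = inj₂ (∉support⇒≡0 w∉)

    ≡0⇒∈Nₑ : ∀ {u} → value G f u ≡ 0 → u ∈ Nₑ G support
    ≡0⇒∈Nₑ {u} fu≡0 with nonempty? (N G u ∩ support)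
    ... | yes (_ , v∈) = ∈Nₑ⁺ (λ u∈ → ∈-comprehension⁻ nonzero? u∈ fu≡0) v∈
    -- With no neighbour in the support, 2≤value applies vacuously to u itself.
    ... | no empty     = contradiction
      (subst (2 ≤_) fu≡0 (2≤value {v = u} fu≡0 λ w∈ → contradiction (_ , w∈) empty)) λ ()

    ∈Dw⇒2≤value : ∀ {v} → v ∈ Dw G support → 2 ≤ value G f v
    ∈Dw⇒2≤value v∈Dw with ∈Dw⁻ v∈Dw
    ... | u , u∉ , T≡v = 2≤value (∉support⇒≡0 u∉) (subst (_ ∈_) T≡v)

    -- A vertex of `Dw G support` needs 2 and has it as its own value. Any other vertex needs 1: it
    -- comes from the indicator inside `Nₑ G support`, and from a nonzero value outside, since every
    -- vertex of value 0 lies in `Nₑ G support`.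
    weight-support : order ℕ.+ ∣ Dw G support ∣ ≤ weight G f ℕ.+ ∣ Nₑ G support ∣
    weight-support = begin
      order ℕ.+ ∣ Dw G support ∣                               ≡⟨ sum-1+indicator (Dw G support) ⟨
      sum (λ v → 1 ℕ.+ indicator (Dw G support) v)             ≤⟨ sum-mono pointwise ⟩
      sum (λ v → value G f v ℕ.+ indicator (Nₑ G support) v)   ≡⟨ sum-+-indicator _ (Nₑ G support) ⟩
      sum (value G f) ℕ.+ ∣ Nₑ G support ∣                     ≡⟨ cong (ℕ._+ ∣ Nₑ G support ∣) (weight≡sum f) ⟨
      weight G f ℕ.+ ∣ Nₑ G support ∣                          ∎
      where
      open ℕ.≤-Reasoning
      pointwise : ∀ v → 1 ℕ.+ indicator (Dw G support) v ≤
                        value G f v ℕ.+ indicator (Nₑ G support) v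
      pointwise v with v ∈? Dw G support | v ∈? Nₑ G support
      ... | yes v∈Dw | _      = ℕ.m≤n⇒m≤n+o _ (∈Dw⇒2≤value v∈Dw)
      ... | no _     | yes _  = ℕ.m≤n+m 1 _
      ... | no _     | no v∉  = ℕ.m≤n⇒m≤n+o _ (ℕ.n≢0⇒n>0 (v∉ ∘ ≡0⇒∈Nₑ))

-- Passage to the integers and conclusion.

[m+d]-d≡m : ∀ m d → + (m ℕ.+ d) ℤ.- + d ≡ + m
[m+d]-d≡m m d = trans (ℤ.+-assoc (+ m) (+ d) (ℤ.- + d))
  (trans (cong (λ z → + m + z) (ℤ.+-inverseʳ (+ d))) (ℤ.+-identityʳ (+ m)))

-- Adding `- d` over `ℤ` to both sides turns the subtraction-free count into a bound involving the
-- differential `e - d`, which may be formed without truncation.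
w+[e-d]≤m : ∀ {w e d m} → w ℕ.+ e ≤ m ℕ.+ d → + w + (+ e ℤ.- + d) ℤ.≤ + m
w+[e-d]≤m {w} {e} {d} {m} le =
  subst₂ ℤ._≤_ (ℤ.+-assoc (+ w) (+ e) (ℤ.- + d)) ([m+d]-d≡m m d)
    (ℤ.+-monoˡ-≤ (ℤ.- + d) (ℤ.+≤+ le))

m≤w+[e-d] : ∀ {w e d m} → m ℕ.+ d ≤ w ℕ.+ e → + m ℤ.≤ + w + (+ e ℤ.- + d)
m≤w+[e-d] {w} {e} {d} {m} le =
  subst₂ ℤ._≤_ ([m+d]-d≡m m d) (ℤ.+-assoc (+ w) (+ e) (ℤ.- + d))
    (ℤ.+-monoˡ-≤ (ℤ.- + d) (ℤ.+≤+ le))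

theorem3p4 : ∀ (G : Graph) → + (γI G) + ∂ₛ G ≡ + (n G)
theorem3p4 G = ℤ.≤-antisym upper lower
  where
  open ℤ.≤-Reasoning

  upper : + (γI G) + ∂ₛ G ℤ.≤ + (n G)
  -- A set attaining `∂ₛ G` yields a labelling whose weight bounds `γI G` from above.
  upper with ∂ₛ-attained G
  ... | D , attained = begin
    + (γI G) + ∂ₛ G                      ≡⟨ cong (λ z → + (γI G) + z) attained ⟨
    + (γI G) + ∂ₛ-of G D                 ≤⟨ ℤ.+-monoˡ-≤ (∂ₛ-of G D)
                                              (ℤ.+≤+ (γI-lower G labelling labelling-isItalian)) ⟩
    + (weight G labelling) + ∂ₛ-of G D   ≤⟨ w+[e-d]≤m weight-labelling ⟩
    + (n G)                              ∎
    where open FromSet G D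

  lower : + (n G) ℤ.≤ + (γI G) + ∂ₛ G
  -- A labelling of minimum weight yields a support whose differential bounds `∂ₛ G` from below.
  lower with γI-attained G
  ... | f , italian , attained = begin
    + (n G)                            ≤⟨ m≤w+[e-d] weight-support ⟩
    + (weight G f) + ∂ₛ-of G support   ≤⟨ ℤ.+-monoʳ-≤ (+ (weight G f)) (∂ₛ-upper G support) ⟩
    + (weight G f) + ∂ₛ G              ≡⟨ cong (λ w → + w + ∂ₛ G) attained ⟩
    + (γI G) + ∂ₛ G                    ∎
    where open FromLabelling G f italian
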